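{- Let $K$ be a field of characteristic zero, let $(p_n(x))_{n\ge 0}$ be a sequence of polynomials in $K[x]$ with $\deg p_n=n$, and let $F^{(y)}:K[x]\to K[x,y]$ be a $K$-linear operator which is shift-invariant, i.e. $F^{(y)}E^{c}=E^{c}F^{(y)}$ for every $c\in K$. Then the following are equivalent: (1) for all $n\ge 0$, $F^{(y)}p_n(x)=\sum_{k=0}^{n}p_k(x)\,p_{n-k}(y)$; (2) the operator $P_x=\epsilon_y\circ F^{(y)}$ is an invertible shift-invariant operator on $K[x]$, the sequence $(p_n(x))_{n\ge0}$ is a Sheffer sequence relative to the divided power sequence $(P_x^{ -1}p_n(x))_{n\ge 0}$, and $F^{(y)}=P_yE^{y}$.
   Context: For $c\in K$, $E^{c}$ denotes the shift $p(x)\mapsto p(x+c)$ (acting on the variable $x$, on $K[x]$ or on $K[x,y]$), and $E^{y}:K[x]\to K[x,y]$ is $p(x)\mapsto p(x+y)$. An operator on $K[x]$ is shift-invariant if it commutes with all $E^{c}$, $c\in K$. $\epsilon_y:K[x,y]\to K[x]$ is evaluation at $y=0$. For an operator $\phi_x$ on $K[x]$, $\phi_y$ denotes the corresponding operator on $K[y]$ obtained by renaming $x$ to $y$ (i.e. $\phi_y\circ\pi=\pi\circ\phi_x$ with $\pi:K[x]\to K[y]$ the isomorphism $x\mapsto y$), extended $K[x]$-linearly to $K[x,y]$; operators on $K[x]$ are extended $K[y]$-linearly to $K[x,y]$. A divided power sequence is a sequence of polynomials $(q_n(x))_{n\ge0}$ with $\deg q_n=n$ and $q_n(x+y)=\sum_{k=0}^n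 q_k(x)q_{n-k}(y)$ for all $n$. A sequence $(s_n(x))_{n\ge0}$ with $\deg s_n=n$ is Sheffer relative to a divided power sequence $(q_n)$ if $s_n(x+y)=\sum_{k=0}^{n}q_{n-k}(y)\,s_k(x)$ for all $n$. -}

module Defs where

open import Level using (Level; _⊔_)
open import Data.Nat.Base as ℕ using (ℕ; zero; suc; _∸_)
open import Data.Fin.Base using (toℕ)
open import Data.List.Base using (List; []; _∷_; map; foldr; length; lookup)
open import Data.Product.Base using (_×_)
open import Function.Base using (_∘_; id)
open import Function.Definitions using (Inverseᵇ)
open import Algebra.Bundles using (CommutativeRing)
open import Algebra.Bundles.Raw using (RawRing)
open import Algebra.Apartness.Bundles using (HeytingField; HeytingCommutativeRing)
open import Algebra.Module.Bundles.Raw using (RawLeftModule)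
open import Algebra.Module.Morphism.Structures using (IsLeftModuleHomomorphism)
import Algebra.Definitions.RawSemiring as SemiringDefinitions

-- Univariate polynomials as coefficient lists, constant term first. Trailing
-- zeros are allowed; the equality compares coefficients and so ignores them.
module Polynomial {c ℓ : Level} (R : RawRing c ℓ) where

  open RawRing R

  Poly : Set c
  Poly = List Carrier

  coeff : Poly → ℕ → Carrier
  coeff []      _       = 0#
  coeff (a ∷ _) zero    = a
  coeff (_ ∷ p) (suc n) = coeff p n

  infix  4 _≈ₚ_
  infixl 6 _+ₚ_
  infixl 7 _*ₚ_
  infixr 7 _·_

  _≈ₚ_ : Poly → Poly → Set ℓ
  p ≈ₚ q = ∀ n → coeff p n ≈ coeff q n

  _+ₚ_ : Poly → Poly → Poly
  []      +ₚ q       = q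
  (a ∷ p) +ₚ []      = a ∷ p
  (a ∷ p) +ₚ (b ∷ q) = (a + b) ∷ (p +ₚ q)

  _·_ : Carrier → Poly → Poly
  a · p = map (a *_) p

  _*ₚ_ : Poly → Poly → Poly
  []      *ₚ q = []
  (a ∷ p) *ₚ q = a · q +ₚ (0# ∷ p *ₚ q)

  const : Carrier → Poly
  const a = a ∷ []

  var : Poly
  var = 0# ∷ 1# ∷ []

  polynomialRing : RawRing c ℓ
  polynomialRing = record
    { Carrier = Poly
    ; _≈_     = _≈ₚ_
    ; _+_     = _+ₚ_
    ; _*_     = _*ₚ_
    ; -_      = map -_
    ; 0#      = []
    ; 1#      = const 1#
    }

  -- Substitution of s for the variable, with coefficients mapped along ι.
  evaluate : ∀ {a b} (S : RawRing a b) →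
             (Carrier → RawRing.Carrier S) → RawRing.Carrier S →
             Poly → RawRing.Carrier S
  evaluate S ι s = foldr (λ a acc → ι a +ₛ s *ₛ acc) (RawRing.0# S)
    where open RawRing S using () renaming (_+_ to _+ₛ_; _*_ to _*ₛ_)

module Operators {c ℓ₁ ℓ₂ : Level} (K : HeytingField c ℓ₁ ℓ₂) where

  private
    module K = HeytingField K

  rawRing : RawRing c ℓ₁
  rawRing = CommutativeRing.rawRing
    (HeytingCommutativeRing.commutativeRing K.heytingCommutativeRing)

  -- K[x,y] is K[x][y]: the outer variable is y, the inner one x.
  private
    module X = Polynomial rawRing
    module Y = Polynomial X.polynomialRing

  K[x] K[x,y] : RawRing c ℓ₁
  K[x]   = X.polynomialRing
  K[x,y] = Y.polynomialRing

  open RawRing K[x] public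
    using () renaming (Carrier to ∣K[x]∣; _≈_ to _≈ˣ_; _+_ to _+ˣ_)
  open RawRing K[x,y] public
    using ()
    renaming (Carrier to ∣K[x,y]∣; _≈_ to _≈ˣʸ_; _+_ to _+ˣʸ_; _*_ to _*ˣʸ_)

  private
    module SX = SemiringDefinitions (RawRing.rawSemiring K[x])
    module SXY = SemiringDefinitions (RawRing.rawSemiring K[x,y])

  -- "Nonzero" is x # 0, the constructive inequality of the field; for a discrete
  -- field # is the negation of ≈, and these are the usual notions.
  CharacteristicZero : Set ℓ₂
  CharacteristicZero = ∀ n → (suc n ×ᴷ K.1#) K.# K.0#
    where open SemiringDefinitions (RawRing.rawSemiring rawRing)
            using () renaming (_×_ to _×ᴷ_)

  HasDegree : ∣K[x]∣ → ℕ → Set (ℓ₁ ⊔ ℓ₂)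
  HasDegree p n =
    (X.coeff p n K.# K.0#) × (∀ m → n ℕ.< m → X.coeff p m K.≈ K.0#)

  infix 9 _⟨x⟩ _⟨y⟩

  _⟨x⟩ _⟨y⟩ : ∣K[x]∣ → ∣K[x,y]∣
  p ⟨x⟩ = Y.const p
  p ⟨y⟩ = map X.const p

  Σ≤ : ℕ → (ℕ → ∣K[x,y]∣) → ∣K[x,y]∣
  Σ≤ n f = SXY.sum {suc n} (f ∘ toℕ)

  K[x]-module K[x,y]-module : RawLeftModule K.Carrier c ℓ₁
  K[x]-module = record
    { Carrierᴹ = ∣K[x]∣
    ; _≈ᴹ_     = _≈ˣ_
    ; _+ᴹ_     = _+ˣ_
    ; _*ₗ_     = X._·_
    ; 0ᴹ       = RawRing.0# K[x]
    ; -ᴹ_      = RawRing.-_ K[x]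
    }
  K[x,y]-module = record
    { Carrierᴹ = ∣K[x,y]∣
    ; _≈ᴹ_     = _≈ˣʸ_
    ; _+ᴹ_     = _+ˣʸ_
    ; _*ₗ_     = λ a → map (a X.·_)
    ; 0ᴹ       = RawRing.0# K[x,y]
    ; -ᴹ_      = RawRing.-_ K[x,y]
    }

  IsOperator : (∣K[x]∣ → ∣K[x]∣) → Set (c ⊔ ℓ₁)
  IsOperator = IsLeftModuleHomomorphism K[x]-module K[x]-module

  IsOperatorˣʸ : (∣K[x]∣ → ∣K[x,y]∣) → Set (c ⊔ ℓ₁)
  IsOperatorˣʸ = IsLeftModuleHomomorphism K[x]-module K[x,y]-module

  -- The K[y]-linear extension of φ to K[x,y].
  onX : (∣K[x]∣ → ∣K[x]∣) → (∣K[x,y]∣ → ∣K[x,y]∣)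
  onX φ = map φ

  -- The K[x]-linear extension of φ_y to K[x,y]:
  -- Σⱼ aⱼ(x) yʲ  ↦  Σⱼ aⱼ(x) (φ xʲ)(y).
  onY : (∣K[x]∣ → ∣K[x]∣) → (∣K[x,y]∣ → ∣K[x,y]∣)
  onY φ u = SXY.sum {length u}
    (λ j → (lookup u j) ⟨x⟩ *ˣʸ (φ (X.var SX.^ toℕ j)) ⟨y⟩)

  E : K.Carrier → ∣K[x]∣ → ∣K[x]∣
  E a = X.evaluate K[x] X.const (X.var +ˣ X.const a)

  Eʸ : ∣K[x]∣ → ∣K[x,y]∣
  Eʸ = X.evaluate K[x,y] (Y.const ∘ X.const) (X.var ⟨x⟩ +ˣʸ X.var ⟨y⟩)

  ε-y : ∣K[x,y]∣ → ∣K[x]∣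
  ε-y = Y.evaluate K[x] id (RawRing.0# K[x])

  ShiftInvariant : (∣K[x]∣ → ∣K[x]∣) → Set (c ⊔ ℓ₁)
  ShiftInvariant φ = ∀ a p → φ (E a p) ≈ˣ E a (φ p)

  ShiftInvariantˣʸ : (∣K[x]∣ → ∣K[x,y]∣) → Set (c ⊔ ℓ₁)
  ShiftInvariantˣʸ F = ∀ a p → F (E a p) ≈ˣʸ onX (E a) (F p)

  record IsDividedPower (q : ℕ → ∣K[x]∣) : Set (ℓ₁ ⊔ ℓ₂) where
    field
      degree   : ∀ n → HasDegree (q n) n
      binomial : ∀ n → Eʸ (q n) ≈ˣʸ Σ≤ n (λ k → q k ⟨x⟩ *ˣʸ q (n ∸ k) ⟨y⟩)

  record IsSheffer (q s : ℕ → ∣K[x]∣) : Set (ℓ₁ ⊔ ℓ₂) where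
    field
      isDividedPower : IsDividedPower q
      degree         : ∀ n → HasDegree (s n) n
      binomial       : ∀ n → Eʸ (s n) ≈ˣʸ Σ≤ n (λ k → q (n ∸ k) ⟨y⟩ *ˣʸ s k ⟨x⟩)

  record IsInverseOperator (P Q : ∣K[x]∣ → ∣K[x]∣) : Set (c ⊔ ℓ₁) where
    field
      isOperator : IsOperator Q
      inverse    : Inverseᵇ _≈ˣ_ _≈ˣ_ P Q

{-# OPTIONS --safe #-}

-- Over a field of characteristic zero a polynomial is determined by its values
-- at the points of K, so every identity below is checked on values. If (1) holds
-- then G = F r is symmetric in x and y, first for r = pₙ and then, the pₙ being a
-- basis, for all r; with shift-invariance G(a, b) = (F E^a r)(0, b) =
-- (F E^a r)(b, 0) = (P E^a r)(b), which is F = P_y E^y. The relation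
-- P pₙ = Σ pₙ₋ₖ(0) pₖ with p₀(0) ≠ 0 shows that P keeps the degree of pₙ, hence is
-- invertible, and applying P⁻¹ in y, and then in x, to (1) gives the binomial
-- identities of the Sheffer and of the divided power sequence. Conversely, P_y
-- applied to the Sheffer identity is (1).

module Submission where

open import Defs
open import Level using (_⊔_)
open import Data.Nat.Base as ℕ using (ℕ; zero; suc; _∸_; z≤n; s≤s)
import Data.Nat.Properties as ℕ
open import Data.Nat.Induction using (<-rec)
open import Data.Fin.Base as Fin using (Fin; toℕ)
open import Data.Fin.Properties using (opposite-prop; toℕ≤pred[n])
import Data.Fin.Permutation as Perm
open import Data.List.Base using ([]; _∷_; map; length; lookup)
open import Data.Product.Base using (_×_; ∃-syntax; _,_; proj₁; proj₂)
open import Data.Sum.Base using (_⊎_; inj₁; inj₂)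
open import Function.Base using (_∘_; id)
open import Function.Bundles using (_⇔_; mk⇔)
open import Relation.Binary.PropositionalEquality.Core as ≡ using (_≡_)
open import Algebra.Bundles using (CommutativeRing)
open import Algebra.Bundles.Raw using (RawRing)
open import Algebra.Apartness.Bundles using (HeytingField; HeytingCommutativeRing)
open import Algebra.Morphism.Structures using (module SemiringMorphisms)
open import Algebra.Module.Morphism.Structures using (IsLeftModuleHomomorphism)
import Algebra.Morphism.Construct.Identity as Identity
import Algebra.Apartness.Properties.HeytingCommutativeRing as HeytingProperties
import Algebra.Definitions.RawSemiring as SemiringDefinitions
import Algebra.Properties.Ring as RingProperties
import Algebra.Properties.Semiring.Sum as SumProperties
import Algebra.Solver.Ring.NaturalCoefficients.Default as SemiringSolver
import Relation.Binary.Reasoning.Setoid as ≈-Reasoning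

-- Evaluation of polynomials as a homomorphism.

module Evaluation {a ℓᵃ c ℓ} (R : RawRing a ℓᵃ) (S : CommutativeRing c ℓ) where

  open Polynomial R
  open CommutativeRing S
  open RawRing rawRing using (rawSemiring)
  open SumProperties semiring
  open SemiringDefinitions rawSemiring using (_^_)
  open SemiringSolver commutativeSemiring using (solve; _:=_; _:+_; _:*_)
  open ≈-Reasoning setoid
  private module R = RawRing R

  -- The source is a raw ring and the target is always `K` below, so only the laws of `K` are called
  -- upon, and `K[x]` and `K[x,y]` stay raw.
  IsHom : (R.Carrier → Carrier) → Set _
  IsHom = SemiringMorphisms.IsSemiringHomomorphism R.rawSemiring rawSemiring

  evaluate-cong : ∀ {ι κ : R.Carrier → Carrier} {s t} → (∀ r → ι r ≈ κ r) → s ≈ t →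
                  ∀ p → evaluate rawRing ι s p ≈ evaluate rawRing κ t p
  evaluate-cong ι≈κ s≈t []      = refl
  evaluate-cong ι≈κ s≈t (a ∷ p) =
    +-cong (ι≈κ a) (*-cong s≈t (evaluate-cong ι≈κ s≈t p))

  evaluate-map : ∀ {b ℓᵇ} (Q : RawRing b ℓᵇ) (ι : R.Carrier → Carrier)
                 (f : RawRing.Carrier Q → R.Carrier) s p →
                 evaluate rawRing ι s (map f p) ≈ Polynomial.evaluate Q rawRing (ι ∘ f) s p
  evaluate-map Q ι f s []      = refl
  evaluate-map Q ι f s (a ∷ p) = +-congˡ (*-congˡ (evaluate-map Q ι f s p))

  -- Passes from the Horner form of `evaluate` to the sum of powers in which `onY` is written.
  evaluate-powers : ∀ (ι : R.Carrier → Carrier) s p →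
    evaluate rawRing ι s p ≈ sum {length p} (λ i → ι (lookup p i) * s ^ toℕ i)
  evaluate-powers ι s []      = refl
  evaluate-powers ι s (a ∷ p) = +-cong (sym (*-identityʳ _)) (begin
    s * evaluate rawRing ι s p
      ≈⟨ *-congˡ (evaluate-powers ι s p) ⟩
    s * sum (λ i → ι (lookup p i) * s ^ toℕ i)
      ≈⟨ *-distribˡ-sum s (λ i → ι (lookup p i) * s ^ toℕ i) ⟩
    sum (λ i → s * (ι (lookup p i) * s ^ toℕ i))
      ≈⟨ sum-cong-≋ (λ i → solve 3 (λ x y z → x :* (y :* z) := y :* (x :* z))
           refl s (ι (lookup p i)) (s ^ toℕ i)) ⟩
    sum (λ i → ι (lookup p i) * s ^ suc (toℕ i)) ∎)

  module _ {ι : R.Carrier → Carrier} (ι-hom : IsHom ι) (s : Carrier) where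

    open SemiringMorphisms.IsSemiringHomomorphism ι-hom

    private
      ev = evaluate rawRing ι s

      -- A trailing zero contributes nothing; this reconciles lists of different lengths in
      -- `ev-cong`.
      ev-0 : ι R.0# + s * 0# ≈ 0#
      ev-0 = trans (+-cong 0#-homo (zeroʳ s)) (+-identityˡ 0#)

      ev-cong : ∀ p q → p ≈ₚ q → ev p ≈ ev q
      ev-cong []      []      _   = refl
      ev-cong []      (b ∷ q) p≈q =
        trans (sym ev-0) (+-cong (⟦⟧-cong (p≈q 0)) (*-congˡ (ev-cong [] q (p≈q ∘ suc))))
      ev-cong (a ∷ p) []      p≈q =
        trans (+-cong (⟦⟧-cong (p≈q 0)) (*-congˡ (ev-cong p [] (p≈q ∘ suc)))) ev-0
      ev-cong (a ∷ p) (b ∷ q) p≈q =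
        +-cong (⟦⟧-cong (p≈q 0)) (*-congˡ (ev-cong p q (p≈q ∘ suc)))

      ev-+ : ∀ p q → ev (p +ₚ q) ≈ ev p + ev q
      ev-+ []      q       = sym (+-identityˡ _)
      ev-+ (a ∷ p) []      = sym (+-identityʳ _)
      ev-+ (a ∷ p) (b ∷ q) = begin
        ι (a R.+ b) + s * ev (p +ₚ q)      ≈⟨ +-cong (+-homo a b) (*-congˡ (ev-+ p q)) ⟩
        ι a + ι b + s * (ev p + ev q)
          ≈⟨ solve 5 (λ x y s u v → x :+ y :+ s :* (u :+ v) := (x :+ s :* u) :+ (y :+ s :* v))
               refl (ι a) (ι b) s (ev p) (ev q) ⟩
        (ι a + s * ev p) + (ι b + s * ev q) ∎

      ev-· : ∀ a p → ev (a · p) ≈ ι a * ev p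
      ev-· a []      = sym (zeroʳ _)
      ev-· a (b ∷ p) = begin
        ι (a R.* b) + s * ev (a · p)  ≈⟨ +-cong (*-homo a b) (*-congˡ (ev-· a p)) ⟩
        ι a * ι b + s * (ι a * ev p)
          ≈⟨ solve 4 (λ x y s u → x :* y :+ s :* (x :* u) := x :* (y :+ s :* u))
               refl (ι a) (ι b) s (ev p) ⟩
        ι a * (ι b + s * ev p)        ∎

      ev-* : ∀ p q → ev (p *ₚ q) ≈ ev p * ev q
      ev-* []      q = sym (zeroˡ _)
      ev-* (a ∷ p) q = begin
        ev (a · q +ₚ (R.0# ∷ p *ₚ q))           ≈⟨ ev-+ (a · q) (R.0# ∷ p *ₚ q) ⟩
        ev (a · q) + (ι R.0# + s * ev (p *ₚ q))
          ≈⟨ +-cong (ev-· a q) (+-cong 0#-homo (*-congˡ (ev-* p q))) ⟩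
        ι a * ev q + (0# + s * (ev p * ev q))
          ≈⟨ +-congˡ (+-identityˡ _) ⟩
        ι a * ev q + s * (ev p * ev q)
          ≈⟨ solve 4 (λ x s u v → x :* v :+ s :* (u :* v) := (x :+ s :* u) :* v)
               refl (ι a) s (ev p) (ev q) ⟩
        (ι a + s * ev p) * ev q                 ∎

    evaluate-const : ∀ a → ev (const a) ≈ ι a
    evaluate-const a = trans (+-congˡ (zeroʳ s)) (+-identityʳ _)

    evaluate-var : ev var ≈ s
    evaluate-var = begin
      ι R.0# + s * (ι R.1# + s * 0#)
        ≈⟨ +-cong 0#-homo (*-congˡ (+-cong 1#-homo (zeroʳ s))) ⟩
      0# + s * (1# + 0#)             ≈⟨ +-identityˡ _ ⟩
      s * (1# + 0#)                  ≈⟨ *-congˡ (+-identityʳ 1#) ⟩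
      s * 1#                         ≈⟨ *-identityʳ s ⟩
      s                              ∎

    evaluate-isHom : SemiringMorphisms.IsSemiringHomomorphism
                       (RawRing.rawSemiring polynomialRing) rawSemiring ev
    evaluate-isHom = record
      { isNearSemiringHomomorphism = record
        { +-isMonoidHomomorphism = record
          { isMagmaHomomorphism = record
            { isRelHomomorphism = record { cong = λ {p} {q} → ev-cong p q }
            ; homo              = ev-+
            }
          ; ε-homo = refl
          }
        ; *-homo = ev-*
        }
      ; 1#-homo = trans (evaluate-const R.1#) 1#-homo
      }

  module _ {h : R.Carrier → Carrier} (h-hom : IsHom h) where

    open SemiringMorphisms.IsSemiringHomomorphism h-hom

    sum-homo : ∀ {n} (f : Fin n → R.Carrier) →
               h (SemiringDefinitions.sum R.rawSemiring f) ≈ sum (h ∘ f)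
    sum-homo {zero}  f = 0#-homo
    sum-homo {suc n} f = trans (+-homo _ _) (+-congˡ (sum-homo (f ∘ Fin.suc)))

    ^-homo : ∀ r n → h (SemiringDefinitions._^_ R.rawSemiring r n) ≈ h r ^ n
    ^-homo r zero    = 1#-homo
    ^-homo r (suc n) = trans (*-homo _ _) (*-congˡ (^-homo r n))

    -- The maps `E`, `Eʸ` and `ε-y` are all substitutions, so this one law yields the values of each
    -- of them at points.
    evaluate-homo : ∀ {b ℓᵇ} (Q : RawRing b ℓᵇ) (ι : RawRing.Carrier Q → R.Carrier) s p →
      h (Polynomial.evaluate Q R ι s p) ≈ Polynomial.evaluate Q rawRing (h ∘ ι) (h s) p
    evaluate-homo Q ι s []      = 0#-homo
    evaluate-homo Q ι s (a ∷ p) = trans (+-homo _ _)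
      (+-congˡ (trans (*-homo _ _) (*-congˡ (evaluate-homo Q ι s p))))

module _ {c ℓ₁ ℓ₂} (K : HeytingField c ℓ₁ ℓ₂) where

  private
    heytingRing = HeytingField.heytingCommutativeRing K
    ring        = HeytingCommutativeRing.commutativeRing heytingRing

  open Operators K
  open HeytingField K using (_#_; #⇒invertible)
  open CommutativeRing ring hiding (ring; rawRing)
  open HeytingProperties heytingRing using (x-0≈x; invertibleˡ⇒#; x#0y#0→xy#0; #-congʳ)
  open RingProperties (CommutativeRing.ring ring) using (-1*x≈-x; -‿distribˡ-*; -0#≈0#; x∙y⁻¹≈ε⇒x≈y)
  open SemiringSolver commutativeSemiring using (solve; _:=_; _:+_; _:*_)
  open SumProperties semiring
  open SemiringDefinitions (RawRing.rawSemiring rawRing) using (_^_) renaming (_×_ to _×ᴷ_)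
  open ≈-Reasoning setoid

  private
    module X  = Polynomial rawRing
    module Y  = Polynomial K[x]
    module SX = SemiringDefinitions (RawRing.rawSemiring K[x])
    module Eᴷ = Evaluation rawRing ring
    module Eˣ = Evaluation K[x] ring
    module Eˣʸ = Evaluation K[x,y] ring

  open X using (coeff; _·_; var)

  -- Apartness and invertibility in a Heyting field.

  inverse-of-#0 : ∀ {x} → x # 0# → ∃[ y ] y * x ≈ 1#
  inverse-of-#0 x#0 with y , yx≈1 , _ ← #⇒invertible x#0 =
    -- The field axiom inverts the difference `x - 0#` rather than `x`.
    y , trans (*-congˡ (sym (x-0≈x _))) yx≈1

  #0-cancelˡ : ∀ {x y} → x # 0# → x * y ≈ 0# → y ≈ 0#
  #0-cancelˡ {x} {y} x#0 xy≈0 with z , zx≈1 ← inverse-of-#0 x#0 = begin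
    y            ≈⟨ *-identityˡ y ⟨
    1# * y       ≈⟨ *-congʳ zx≈1 ⟨
    z * x * y    ≈⟨ *-assoc z x y ⟩
    z * (x * y)  ≈⟨ *-congˡ xy≈0 ⟩
    z * 0#       ≈⟨ zeroʳ z ⟩
    0#           ∎

  -- Apartness from zero amounts to invertibility, and `z * x` inverts `y` once `z` inverts `x * y`.
  xy#0→y#0 : ∀ {x y} → x * y # 0# → y # 0#
  xy#0→y#0 {x} {y} xy#0 with z , zxy≈1 ← inverse-of-#0 xy#0 =
    invertibleˡ⇒# (z * x , (begin
      z * x * (y - 0#)  ≈⟨ *-congˡ (x-0≈x y) ⟩
      z * x * y         ≈⟨ *-assoc z x y ⟩
      z * (x * y)       ≈⟨ zxy≈1 ⟩
      1#                ∎))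

  -- Convolutions of scalar sequences.

  convolve : (f g : ℕ → Carrier) → ℕ → Carrier
  convolve f g n = sum {suc n} (λ i → f (toℕ i) * g (n ∸ toℕ i))

  convolve-cong : ∀ f {g h} → (∀ k → g k ≈ h k) → ∀ n → convolve f g n ≈ convolve f h n
  convolve-cong f g≈h n = sum-cong-≋ {suc n} (λ i → *-congˡ {f (toℕ i)} (g≈h (n ∸ toℕ i)))

  -- Reversing the index set exchanges the two factors. The symmetry of `F` in x and y rests on
  -- this.
  convolve-comm : ∀ f g n → convolve f g n ≈ convolve g f n
  convolve-comm f g n = trans
    (sum-permute {suc n} (λ i → f (toℕ i) * g (n ∸ toℕ i)) Perm.reverse)
    (sum-cong-≋ {suc n} (λ i → trans
      (reflexive (≡.cong₂ (λ k l → f k * g l) (opposite-prop i)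
        (≡.trans (≡.cong (n ∸_) (opposite-prop i)) (ℕ.m∸[m∸n]≡n (toℕ≤pred[n] i)))))
      (*-comm (f (n ∸ toℕ i)) (g (toℕ i)))))

  -- Only the index 0 reaches `g n`; every other term has a factor `g k` with k < n.
  convolve-leading : ∀ f g n → (∀ k → k ℕ.< n → g k ≈ 0#) → convolve f g n ≈ f 0 * g n
  convolve-leading f g zero    _   = +-identityʳ _
  convolve-leading f g (suc n) g≈0 = begin
    f 0 * g (suc n) + sum {suc n} (λ i → f (suc (toℕ i)) * g (n ∸ toℕ i))
      ≈⟨ +-congˡ (sum-cong-≋ {suc n} (λ i →
           trans (*-congˡ {f (suc (toℕ i))} (g≈0 (n ∸ toℕ i) (s≤s (ℕ.m∸n≤m n (toℕ i))))) (zeroʳ _))) ⟩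
    f 0 * g (suc n) + sum {suc n} (λ _ → 0#)
      ≈⟨ +-congˡ (sum-replicate-zero (suc n)) ⟩
    f 0 * g (suc n) + 0#    ≈⟨ +-identityʳ _ ⟩
    f 0 * g (suc n)         ∎

  -- Coefficients and linear functionals on K[x].

  coeff-map : ∀ {f : Carrier → Carrier} → f 0# ≈ 0# →
              ∀ p n → coeff (map f p) n ≈ f (coeff p n)
  coeff-map f0≈0 []      n       = sym f0≈0
  coeff-map f0≈0 (a ∷ p) zero    = refl
  coeff-map f0≈0 (a ∷ p) (suc n) = coeff-map f0≈0 p n

  coeff-+ : ∀ p q n → coeff (p +ˣ q) n ≈ coeff p n + coeff q n
  coeff-+ []      q       n       = sym (+-identityˡ _)
  coeff-+ (a ∷ p) []      n       = sym (+-identityʳ _)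
  coeff-+ (a ∷ p) (b ∷ q) zero    = refl
  coeff-+ (a ∷ p) (b ∷ q) (suc n) = coeff-+ p q n

  coeff-beyond-length : ∀ p {n} → length p ℕ.≤ n → coeff p n ≈ 0#
  coeff-beyond-length []      _         = refl
  coeff-beyond-length (a ∷ p) (s≤s l≤n) = coeff-beyond-length p l≤n

  -- Coefficients, values at points and their composites with operators all have this form, so a
  -- linear identity is proved once and then read on coefficients or on values.
  record IsFunctional (L : ∣K[x]∣ → Carrier) : Set (c ⊔ ℓ₁) where
    field
      cong   : ∀ p q → p ≈ˣ q → L p ≈ L q
      +-homo : ∀ p q → L (p +ˣ q) ≈ L p + L q
      ·-homo : ∀ a p → L (a · p) ≈ a * L p

    0-homo : L [] ≈ 0#
    0-homo = trans (·-homo 0# []) (zeroˡ _)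

  coeff-functional : ∀ n → IsFunctional (λ p → coeff p n)
  coeff-functional n = record
    { cong   = λ p q p≈q → p≈q n
    ; +-homo = λ p q → coeff-+ p q n
    ; ·-homo = λ a p → coeff-map (zeroʳ a) p n
    }

  functional-resp : ∀ {L M} → (∀ p → L p ≈ M p) → IsFunctional M → IsFunctional L
  functional-resp L≈M M-fun = record
    { cong   = λ p q p≈q → trans (L≈M _) (trans (cong p q p≈q) (sym (L≈M _)))
    ; +-homo = λ p q → trans (L≈M _) (trans (+-homo p q) (+-cong (sym (L≈M p)) (sym (L≈M q))))
    ; ·-homo = λ a p → trans (L≈M _) (trans (·-homo a p) (*-congˡ (sym (L≈M p))))
    }
    where open IsFunctional M-fun

  -- Values of polynomials in one and in two variables.

  id-hom : Eᴷ.IsHom id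
  id-hom = Identity.isSemiringHomomorphism (RawRing.rawSemiring rawRing) refl

  ev : Carrier → ∣K[x]∣ → Carrier
  ev a = X.evaluate rawRing id a

  ev-hom : ∀ a → Eˣ.IsHom (ev a)
  ev-hom = Eᴷ.evaluate-isHom id-hom

  module Ev a = SemiringMorphisms.IsSemiringHomomorphism (ev-hom a)

  ev-congˡ : ∀ {a b} → a ≈ b → ∀ p → ev a p ≈ ev b p
  ev-congˡ = Eᴷ.evaluate-cong (λ _ → refl)

  ev-const : ∀ a b → ev a (X.const b) ≈ b
  ev-const a b = Eᴷ.evaluate-const id-hom a b

  ev-var : ∀ a → ev a var ≈ a
  ev-var = Eᴷ.evaluate-var id-hom

  ev-· : ∀ a b p → ev a (b · p) ≈ b * ev a p
  ev-· a b []      = sym (zeroʳ b)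
  ev-· a b (d ∷ p) = begin
    b * d + a * ev a (b · p)    ≈⟨ +-congˡ (*-congˡ (ev-· a b p)) ⟩
    b * d + a * (b * ev a p)
      ≈⟨ solve 4 (λ b d a e → b :* d :+ a :* (b :* e) := b :* (d :+ a :* e)) refl b d a (ev a p) ⟩
    b * (d + a * ev a p)        ∎

  ev-functional : ∀ a → IsFunctional (ev a)
  ev-functional a = record { cong = λ p q → Ev.⟦⟧-cong a {p} {q} ; +-homo = Ev.+-homo a ; ·-homo = ev-· a }

  ev-0 : ∀ p → ev 0# p ≈ coeff p 0
  ev-0 []      = refl
  ev-0 (a ∷ p) = trans (+-congˡ (zeroˡ _)) (+-identityʳ a)

  ev-E : ∀ a b p → ev a (E b p) ≈ ev (a + b) p
  ev-E a b p = trans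
    (Eˣ.evaluate-homo (ev-hom a) rawRing X.const (var +ˣ X.const b) p)
    (Eᴷ.evaluate-cong (ev-const a)
      (trans (Ev.+-homo a var (X.const b)) (+-cong (ev-var a) (ev-const a b))) p)

  ev₂ : Carrier → Carrier → ∣K[x,y]∣ → Carrier
  ev₂ a b = Y.evaluate rawRing (ev a) b

  ev₂-hom : ∀ a b → Eˣʸ.IsHom (ev₂ a b)
  ev₂-hom a = Eˣ.evaluate-isHom (ev-hom a)

  module Ev₂ a b = SemiringMorphisms.IsSemiringHomomorphism (ev₂-hom a b)

  ev₂-cong : ∀ a b u v → u ≈ˣʸ v → ev₂ a b u ≈ ev₂ a b v
  ev₂-cong a b u v = Ev₂.⟦⟧-cong a b {u} {v}

  ev₂-congᵃ : ∀ {a b d e} → a ≈ d → b ≈ e → ∀ u → ev₂ a b u ≈ ev₂ d e u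
  ev₂-congᵃ a≈d b≈e = Eˣ.evaluate-cong (ev-congˡ a≈d) b≈e

  ev₂-⟨x⟩ : ∀ a b p → ev₂ a b (p ⟨x⟩) ≈ ev a p
  ev₂-⟨x⟩ a b = Eˣ.evaluate-const (ev-hom a) b

  ev₂-⟨y⟩ : ∀ a b p → ev₂ a b (p ⟨y⟩) ≈ ev b p
  ev₂-⟨y⟩ a b p = trans (Eˣ.evaluate-map rawRing (ev a) X.const b p)
    (Eᴷ.evaluate-cong (ev-const a) refl p)

  ev₂-product : ∀ a b p q → ev₂ a b (p ⟨x⟩ *ˣʸ q ⟨y⟩) ≈ ev a p * ev b q
  ev₂-product a b p q = trans (Ev₂.*-homo a b (p ⟨x⟩) (q ⟨y⟩))
    (*-cong (ev₂-⟨x⟩ a b p) (ev₂-⟨y⟩ a b q))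

  ev₂-Σ≤ : ∀ a b n (f : ℕ → ∣K[x,y]∣) →
           ev₂ a b (Σ≤ n f) ≈ sum {suc n} (λ i → ev₂ a b (f (toℕ i)))
  ev₂-Σ≤ a b n f = Eˣʸ.sum-homo (ev₂-hom a b) {suc n} (f ∘ toℕ)

  ev₂-convolution : ∀ u v n a b →
    ev₂ a b (Σ≤ n (λ k → u k ⟨x⟩ *ˣʸ v (n ∸ k) ⟨y⟩)) ≈ convolve (ev a ∘ u) (ev b ∘ v) n
  ev₂-convolution u v n a b = trans
    (ev₂-Σ≤ a b n (λ k → u k ⟨x⟩ *ˣʸ v (n ∸ k) ⟨y⟩))
    (sum-cong-≋ {suc n} (λ i → ev₂-product a b (u (toℕ i)) (v (n ∸ toℕ i))))

  -- The variant for the Sheffer identity, which puts the factor in y first.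
  ev₂-convolution′ : ∀ u v n a b →
    ev₂ a b (Σ≤ n (λ k → v (n ∸ k) ⟨y⟩ *ˣʸ u k ⟨x⟩)) ≈ convolve (ev a ∘ u) (ev b ∘ v) n
  ev₂-convolution′ u v n a b = trans
    (ev₂-Σ≤ a b n (λ k → v (n ∸ k) ⟨y⟩ *ˣʸ u k ⟨x⟩))
    (sum-cong-≋ {suc n} (λ i → trans
      (Ev₂.*-homo a b (v (n ∸ toℕ i) ⟨y⟩) (u (toℕ i) ⟨x⟩))
      (trans (*-cong (ev₂-⟨y⟩ a b (v (n ∸ toℕ i))) (ev₂-⟨x⟩ a b (u (toℕ i)))) (*-comm _ _))))

  ev₂-Eʸ : ∀ a b p → ev₂ a b (Eʸ p) ≈ ev (a + b) p
  ev₂-Eʸ a b p = trans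
    (Eˣʸ.evaluate-homo (ev₂-hom a b) rawRing (Y.const ∘ X.const) (var ⟨x⟩ +ˣʸ var ⟨y⟩) p)
    (Eᴷ.evaluate-cong (λ r → trans (ev₂-⟨x⟩ a b (X.const r)) (ev-const a r))
      (trans (Ev₂.+-homo a b (var ⟨x⟩) (var ⟨y⟩))
        (+-cong (trans (ev₂-⟨x⟩ a b var) (ev-var a)) (trans (ev₂-⟨y⟩ a b var) (ev-var b)))) p)

  ev-E-comm : ∀ a b p → ev a (E b p) ≈ ev b (E a p)
  ev-E-comm a b p = trans (ev-E a b p) (trans (ev-congˡ (+-comm a b) p) (sym (ev-E b a p)))

  -- Fixing x = a in p(x + y) leaves the shift of `p` by `a`, in the variable y. An operator acting
  -- in y can therefore be studied on `E a p`.
  ev-E-Eʸ : ∀ a b p → ev b (E a p) ≈ ev₂ a b (Eʸ p)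
  ev-E-Eʸ a b p = trans (ev-E-comm b a p) (trans (ev-E a b p) (sym (ev₂-Eʸ a b p)))

  ev-ε-y : ∀ a u → ev a (ε-y u) ≈ ev₂ a 0# u
  ev-ε-y a = Eˣ.evaluate-homo (ev-hom a) K[x] id []

  ev₂-onX-E : ∀ a b d u → ev₂ a b (onX (E d) u) ≈ ev₂ (a + d) b u
  ev₂-onX-E a b d u = trans (Eˣ.evaluate-map K[x] (ev a) (E d) b u)
    (Eˣ.evaluate-cong (ev-E a d) refl u)

  ev₂-· : ∀ a b d u → ev₂ a b (map (d ·_) u) ≈ d * ev₂ a b u
  ev₂-· a b d []      = sym (zeroʳ d)
  ev₂-· a b d (p ∷ u) = begin
    ev a (d · p) + b * ev₂ a b (map (d ·_) u)
      ≈⟨ +-cong (ev-· a d p) (*-congˡ (ev₂-· a b d u)) ⟩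
    d * ev a p + b * (d * ev₂ a b u)
      ≈⟨ solve 4 (λ d p b e → d :* p :+ b :* (d :* e) := d :* (p :+ b :* e))
           refl d (ev a p) b (ev₂ a b u) ⟩
    d * (ev a p + b * ev₂ a b u) ∎

  -- Functionals, operators and linear combinations.

  ev₂-functional : ∀ {F} → IsOperatorˣʸ F → ∀ a b → IsFunctional (ev₂ a b ∘ F)
  ev₂-functional {F} F-op a b = record
    { cong   = λ p q p≈q → ev₂-cong a b (F p) (F q) (⟦⟧-cong p≈q)
    ; +-homo = λ p q → trans (ev₂-cong a b (F (p +ˣ q)) (F p +ˣʸ F q) (+ᴹ-homo p q))
                             (Ev₂.+-homo a b (F p) (F q))
    ; ·-homo = λ d p → trans (ev₂-cong a b (F (d · p)) (map (d ·_) (F p)) (*ₗ-homo d p))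
                             (ev₂-· a b d (F p))
    }
    where open IsLeftModuleHomomorphism F-op

  functional-∘ : ∀ {L φ} → IsFunctional L → IsOperator φ → IsFunctional (L ∘ φ)
  functional-∘ {φ = φ} L-fun φ-op = record
    { cong   = λ p q p≈q → cong (φ p) (φ q) (⟦⟧-cong p≈q)
    ; +-homo = λ p q → trans (cong (φ (p +ˣ q)) (φ p +ˣ φ q) (+ᴹ-homo p q)) (+-homo _ _)
    ; ·-homo = λ d p → trans (cong (φ (d · p)) (d · φ p) (*ₗ-homo d p)) (·-homo d _)
    }
    where
    open IsFunctional L-fun
    open IsLeftModuleHomomorphism φ-op

  -- Differences are formed with the scalar `- 1#`, so that additivity and homogeneity cover them.
  functional-difference : ∀ {L} → IsFunctional L → ∀ p q → L (p +ˣ - 1# · q) ≈ L p - L q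
  functional-difference L-fun p q =
    trans (+-homo p _) (+-congˡ (trans (·-homo (- 1#) q) (-1*x≈-x _)))
    where open IsFunctional L-fun

  ≈ˣ-from-difference : ∀ p q → p +ˣ - 1# · q ≈ˣ [] → p ≈ˣ q
  ≈ˣ-from-difference p q d≈0 n = x∙y⁻¹≈ε⇒x≈y (coeff p n) (coeff q n)
    (trans (sym (functional-difference (coeff-functional n) p q)) (d≈0 n))

  -- Here a polynomial doubles as a finite vector of coordinates. For `w = L ∘ s` this is the value
  -- of the functional `L` on `combine s r`.
  dot : (ℕ → Carrier) → ∣K[x]∣ → Carrier
  dot w r = sum {length r} (λ i → lookup r i * w (toℕ i))

  dot-zero : ∀ w r → r ≈ˣ [] → dot w r ≈ 0#
  dot-zero w []      _   = refl
  dot-zero w (a ∷ r) r≈0 = begin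
    a * w 0 + dot (w ∘ suc) r
      ≈⟨ +-cong (*-congʳ (r≈0 0)) (dot-zero (w ∘ suc) r (λ n → r≈0 (suc n))) ⟩
    0# * w 0 + 0#                ≈⟨ +-identityʳ _ ⟩
    0# * w 0                     ≈⟨ zeroˡ _ ⟩
    0#                           ∎

  dot-cong : ∀ w p q → p ≈ˣ q → dot w p ≈ dot w q
  dot-cong w []      q       p≈q = sym (dot-zero w q (λ n → sym (p≈q n)))
  dot-cong w (a ∷ p) []      p≈q = dot-zero w (a ∷ p) p≈q
  dot-cong w (a ∷ p) (b ∷ q) p≈q =
    +-cong (*-congʳ (p≈q 0)) (dot-cong (w ∘ suc) p q (λ n → p≈q (suc n)))

  dot-+ : ∀ w p q → dot w (p +ˣ q) ≈ dot w p + dot w q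
  dot-+ w []      q       = sym (+-identityˡ _)
  dot-+ w (a ∷ p) []      = sym (+-identityʳ _)
  dot-+ w (a ∷ p) (b ∷ q) = begin
    (a + b) * w 0 + dot (w ∘ suc) (p +ˣ q)
      ≈⟨ +-congˡ (dot-+ (w ∘ suc) p q) ⟩
    (a + b) * w 0 + (dot (w ∘ suc) p + dot (w ∘ suc) q)
      ≈⟨ solve 5 (λ a b v x y → (a :+ b) :* v :+ (x :+ y) := (a :* v :+ x) :+ (b :* v :+ y))
           refl a b (w 0) (dot (w ∘ suc) p) (dot (w ∘ suc) q) ⟩
    dot w (a ∷ p) + dot w (b ∷ q) ∎

  dot-· : ∀ w a p → dot w (a · p) ≈ a * dot w p
  dot-· w a []      = sym (zeroʳ a)
  dot-· w a (b ∷ p) = begin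
    a * b * w 0 + dot (w ∘ suc) (a · p)
      ≈⟨ +-congˡ (dot-· (w ∘ suc) a p) ⟩
    a * b * w 0 + a * dot (w ∘ suc) p
      ≈⟨ solve 4 (λ a b v x → a :* b :* v :+ a :* x := a :* (b :* v :+ x))
           refl a b (w 0) (dot (w ∘ suc) p) ⟩
    a * dot w (b ∷ p) ∎

  -- Below n the weights vanish and above n the coordinates do, which leaves a single term.
  dot-leading : ∀ w r n → (∀ k → k ℕ.< n → w k ≈ 0#) → (∀ m → n ℕ.< m → coeff r m ≈ 0#) →
                dot w r ≈ coeff r n * w n
  dot-leading w []      n       _     _    = sym (zeroˡ _)
  dot-leading w (a ∷ r) zero    _     high = begin
    a * w 0 + dot (w ∘ suc) r
      ≈⟨ +-congˡ (dot-zero (w ∘ suc) r (λ n → high (suc n) (s≤s z≤n))) ⟩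
    a * w 0 + 0#                ≈⟨ +-identityʳ _ ⟩
    a * w 0                     ∎
  dot-leading w (a ∷ r) (suc n) low   high = begin
    a * w 0 + dot (w ∘ suc) r
      ≈⟨ +-cong (trans (*-congˡ (low 0 (s≤s z≤n))) (zeroʳ a))
           (dot-leading (w ∘ suc) r n (λ k k<n → low (suc k) (s≤s k<n))
             (λ m n<m → high (suc m) (s≤s n<m))) ⟩
    0# + coeff r n * w (suc n)  ≈⟨ +-identityˡ _ ⟩
    coeff r n * w (suc n)       ∎

  monomial : Carrier → ℕ → ∣K[x]∣
  monomial t zero    = t ∷ []
  monomial t (suc n) = 0# ∷ monomial t n

  dot-monomial : ∀ w t n → dot w (monomial t n) ≈ t * w n
  dot-monomial w t zero    = +-identityʳ _
  dot-monomial w t (suc n) =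
    trans (+-cong (zeroˡ _) (dot-monomial (w ∘ suc) t n)) (+-identityˡ _)

  -- For m ≥ n the polynomials `v k` with k < n have no coefficient at m, and the term with `v n`
  -- remains. Degrees are assumed only for k < n, so that an induction can find the degree of `v n`
  -- from that of `u`.
  convolve-coeff : ∀ (f : ℕ → Carrier) (v : ℕ → ∣K[x]∣) u n →
    (∀ m → coeff u m ≈ convolve f (λ k → coeff (v k) m) n) →
    (∀ k → k ℕ.< n → HasDegree (v k) k) → ∀ m → n ℕ.≤ m → coeff u m ≈ f 0 * coeff (v n) m
  convolve-coeff f v u n u≈ v-degree m n≤m = trans (u≈ m)
    (convolve-leading f (λ k → coeff (v k) m) n
      (λ k k<n → proj₂ (v-degree k k<n) m (ℕ.<-≤-trans k<n n≤m)))

  linearCombination : ∀ {n} → (Fin n → Carrier) → (Fin n → ∣K[x]∣) → ∣K[x]∣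
  linearCombination c s = SX.sum (λ i → c i · s i)

  functional-linearCombination : ∀ {L} → IsFunctional L → ∀ {n} (c : Fin n → Carrier) s →
    L (linearCombination c s) ≈ sum (λ i → c i * L (s i))
  functional-linearCombination L-fun {zero}  c s = IsFunctional.0-homo L-fun
  functional-linearCombination L-fun {suc n} c s =
    trans (+-homo (c Fin.zero · s Fin.zero) _)
      (+-cong (·-homo (c Fin.zero) (s Fin.zero))
        (functional-linearCombination L-fun (c ∘ Fin.suc) (s ∘ Fin.suc)))
    where open IsFunctional L-fun

  -- Zero and negation are preserved by homogeneity at the scalars `0#` and `- 1#`.
  isOperator : ∀ {φ} → (∀ p q → p ≈ˣ q → φ p ≈ˣ φ q) →
               (∀ p q → φ (p +ˣ q) ≈ˣ φ p +ˣ φ q) → (∀ a p → φ (a · p) ≈ˣ a · φ p) →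
               IsOperator φ
  isOperator {φ} φ-cong φ-+ φ-· = record
    { +ᴹ-isGroupHomomorphism = record
      { isMonoidHomomorphism = record
        { isMagmaHomomorphism = record
          { isRelHomomorphism = record { cong = φ-cong _ _ }
          ; homo              = φ-+
          }
        ; ε-homo = λ n → trans (φ-· 0# [] n) (trans (coeff-map (zeroʳ 0#) (φ []) n) (zeroˡ _))
        }
      ; ⁻¹-homo = λ p n → begin
          coeff (φ (map -_ p)) n     ≈⟨ φ-cong (map -_ p) (- 1# · p) (-p≈-1·p p) n ⟩
          coeff (φ (- 1# · p)) n     ≈⟨ φ-· (- 1#) p n ⟩
          coeff (- 1# · φ p) n       ≈⟨ -p≈-1·p (φ p) n ⟨
          coeff (map -_ (φ p)) n     ∎
      }
    ; *ₗ-homo = φ-·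
    }
    where
    -p≈-1·p : ∀ p → map -_ p ≈ˣ - 1# · p
    -p≈-1·p p n = begin
      coeff (map -_ p) n    ≈⟨ coeff-map -0#≈0# p n ⟩
      - coeff p n           ≈⟨ -1*x≈-x _ ⟨
      - 1# * coeff p n      ≈⟨ coeff-map (zeroʳ _) p n ⟨
      coeff (- 1# · p) n    ∎

  combine : (ℕ → ∣K[x]∣) → ∣K[x]∣ → ∣K[x]∣
  combine s r = linearCombination {length r} (lookup r) (s ∘ toℕ)

  functional-combine : ∀ {L} → IsFunctional L → ∀ s r → L (combine s r) ≈ dot (L ∘ s) r
  functional-combine L-fun s r = functional-linearCombination L-fun {length r} (lookup r) (s ∘ toℕ)

  operator-combine : ∀ {φ} → IsOperator φ → ∀ s r → φ (combine s r) ≈ˣ combine (φ ∘ s) r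
  operator-combine {φ} φ-op s r n = trans
    (functional-combine (functional-∘ (coeff-functional n) φ-op) s r)
    (sym (functional-combine (coeff-functional n) (φ ∘ s) r))

  combine-cong : ∀ s p q → p ≈ˣ q → combine s p ≈ˣ combine s q
  combine-cong s p q p≈q n = trans (functional-combine (coeff-functional n) s p)
    (trans (dot-cong (λ k → coeff (s k) n) p q p≈q) (sym (functional-combine (coeff-functional n) s q)))

  -- Bases with one polynomial in each degree.

  module Graded (s : ℕ → ∣K[x]∣) (s-degree : ∀ n → HasDegree (s n) n) where

    reciprocal : ℕ → Carrier
    reciprocal n = proj₁ (inverse-of-#0 (proj₁ (s-degree n)))

    reciprocal-spec : ∀ n → reciprocal n * coeff (s n) n ≈ 1#
    reciprocal-spec n = proj₂ (inverse-of-#0 (proj₁ (s-degree n)))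

    -- Linear independence. If the coordinates beyond n vanish, the coefficient of the combination
    -- at n is the n-th coordinate times the leading coefficient of `s n`; hence that coordinate
    -- vanishes too and the bound drops by one.
    combine-kernel : ∀ r → combine s r ≈ˣ [] → r ≈ˣ []
    combine-kernel r s·r≈0 = descend (length r) (λ m → coeff-beyond-length r)
      where
      descend : ∀ n → (∀ m → n ℕ.≤ m → coeff r m ≈ 0#) → r ≈ˣ []
      descend zero    high m = high m z≤n
      descend (suc n) high   = descend n λ m n≤m → case (ℕ.m≤n⇒m<n∨m≡n n≤m)
        where
        top≈0 : coeff r n ≈ 0#
        top≈0 = #0-cancelˡ (proj₁ (s-degree n)) (begin
          coeff (s n) n * coeff r n          ≈⟨ *-comm _ _ ⟩
          coeff r n * coeff (s n) n
            ≈⟨ dot-leading (λ k → coeff (s k) n) r n (λ k k<n → proj₂ (s-degree k) n k<n) high ⟨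
          dot (λ k → coeff (s k) n) r        ≈⟨ functional-combine (coeff-functional n) s r ⟨
          coeff (combine s r) n              ≈⟨ s·r≈0 n ⟩
          0#                                 ∎)
        case : ∀ {m} → n ℕ.< m ⊎ n ≡ m → coeff r m ≈ 0#
        case (inj₁ n<m)    = high _ n<m
        case (inj₂ ≡.refl) = top≈0

    -- One elimination step: the scalar is chosen to cancel the coefficient at n.
    truncate : ℕ → ∣K[x]∣ → ∣K[x]∣
    truncate n r = r +ˣ (- (coeff r n * reciprocal n)) · s n

    truncate-high : ∀ n r → (∀ m → suc n ℕ.≤ m → coeff r m ≈ 0#) →
                    ∀ m → n ℕ.≤ m → coeff (truncate n r) m ≈ 0#
    truncate-high n r high m n≤m = trans
      (trans (coeff-+ r _ m) (+-congˡ (coeff-map (zeroʳ _) (s n) m)))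
      (case (ℕ.m≤n⇒m<n∨m≡n n≤m))
      where
      t = coeff r n * reciprocal n
      case : n ℕ.< m ⊎ n ≡ m → coeff r m + - t * coeff (s n) m ≈ 0#
      case (inj₁ n<m) = trans
        (+-cong (high m n<m) (trans (*-congˡ (proj₂ (s-degree n) m n<m)) (zeroʳ _)))
        (+-identityˡ 0#)
      case (inj₂ ≡.refl) = begin
        coeff r n + - t * coeff (s n) n    ≈⟨ +-congˡ (-‿distribˡ-* t _) ⟨
        coeff r n - t * coeff (s n) n      ≈⟨ +-congˡ (-‿cong (*-assoc _ _ _)) ⟩
        coeff r n - coeff r n * (reciprocal n * coeff (s n) n)
          ≈⟨ +-congˡ (-‿cong (trans (*-congˡ (reciprocal-spec n)) (*-identityʳ _))) ⟩
        coeff r n - coeff r n              ≈⟨ -‿inverseʳ _ ⟩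
        0#                                 ∎

    -- Elimination from the top. The recursion runs on a strict bound for the degree because
    -- `truncate` does not shorten the list.
    coordinates-below : ℕ → ∣K[x]∣ → ∣K[x]∣
    coordinates-below zero    r = []
    coordinates-below (suc n) r =
      coordinates-below n (truncate n r) +ˣ monomial (coeff r n * reciprocal n) n

    -- What `truncate` takes away is given back by the added monomial. An arbitrary `L` serves both
    -- the spanning property, through coefficients, and `functionals-agree`.
    dot-coordinates-below : ∀ {L} → IsFunctional L → ∀ n r →
      (∀ m → n ℕ.≤ m → coeff r m ≈ 0#) → dot (L ∘ s) (coordinates-below n r) ≈ L r
    dot-coordinates-below L-fun zero    r high =
      sym (trans (cong r [] (λ m → high m z≤n)) 0-homo)
      where open IsFunctional L-fun
    dot-coordinates-below {L} L-fun (suc n) r high = begin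
      dot (L ∘ s) (coordinates-below n (truncate n r) +ˣ monomial t n)
        ≈⟨ dot-+ (L ∘ s) (coordinates-below n (truncate n r)) (monomial t n) ⟩
      dot (L ∘ s) (coordinates-below n (truncate n r)) + dot (L ∘ s) (monomial t n)
        ≈⟨ +-cong (dot-coordinates-below L-fun n (truncate n r) (truncate-high n r high))
             (dot-monomial (L ∘ s) t n) ⟩
      L (truncate n r) + t * L (s n)
        ≈⟨ +-congʳ (trans (+-homo r _) (+-congˡ (·-homo (- t) (s n)))) ⟩
      L r + - t * L (s n) + t * L (s n)
        ≈⟨ +-assoc _ _ _ ⟩
      L r + (- t * L (s n) + t * L (s n))
        ≈⟨ +-congˡ (trans (sym (distribʳ (L (s n)) (- t) t))
             (trans (*-congʳ (-‿inverseˡ t)) (zeroˡ _))) ⟩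
      L r + 0#
        ≈⟨ +-identityʳ _ ⟩
      L r ∎
      where
      open IsFunctional L-fun
      t = coeff r n * reciprocal n

    coordinates : ∣K[x]∣ → ∣K[x]∣
    coordinates r = coordinates-below (length r) r

    dot-coordinates : ∀ {L} → IsFunctional L → ∀ r → dot (L ∘ s) (coordinates r) ≈ L r
    dot-coordinates L-fun r =
      dot-coordinates-below L-fun (length r) r (λ m → coeff-beyond-length r)

    combine-coordinates : ∀ r → combine s (coordinates r) ≈ˣ r
    combine-coordinates r n = trans
      (functional-combine (coeff-functional n) s (coordinates r))
      (dot-coordinates (coeff-functional n) r)

    functionals-agree : ∀ {L M} → IsFunctional L → IsFunctional M →
                        (∀ n → L (s n) ≈ M (s n)) → ∀ r → L r ≈ M r
    functionals-agree {L} {M} L-fun M-fun L≈M r = begin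
      L r                         ≈⟨ dot-coordinates L-fun r ⟨
      dot (L ∘ s) (coordinates r)
        ≈⟨ sum-cong-≋ {length (coordinates r)} (λ i → *-congˡ (L≈M (toℕ i))) ⟩
      dot (M ∘ s) (coordinates r) ≈⟨ dot-coordinates M-fun r ⟩
      M r                         ∎

  -- Inverting operators that preserve degrees.

  sectionIsInverse : ∀ {T S} → IsOperator T → (∀ r → T r ≈ˣ [] → r ≈ˣ []) →
                     (∀ r → T (S r) ≈ˣ r) → IsInverseOperator T S
  sectionIsInverse {T} {S} T-op kernel section = record
    { isOperator = isOperator
        (λ p q p≈q → injective (S p) (S q) λ n → begin
          coeff (T (S p)) n  ≈⟨ section p n ⟩
          coeff p n          ≈⟨ p≈q n ⟩
          coeff q n          ≈⟨ section q n ⟨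
          coeff (T (S q)) n  ∎)
        (λ p q → injective (S (p +ˣ q)) (S p +ˣ S q) λ n → begin
          coeff (T (S (p +ˣ q))) n                   ≈⟨ section (p +ˣ q) n ⟩
          coeff (p +ˣ q) n                           ≈⟨ coeff-+ p q n ⟩
          coeff p n + coeff q n                      ≈⟨ +-cong (section p n) (section q n) ⟨
          coeff (T (S p)) n + coeff (T (S q)) n      ≈⟨ T.+-homo n (S p) (S q) ⟨
          coeff (T (S p +ˣ S q)) n                   ∎)
        (λ a p → injective (S (a · p)) (a · S p) λ n → begin
          coeff (T (S (a · p))) n    ≈⟨ section (a · p) n ⟩
          coeff (a · p) n            ≈⟨ coeff-map (zeroʳ a) p n ⟩
          a * coeff p n              ≈⟨ *-congˡ (section p n) ⟨
          a * coeff (T (S p)) n      ≈⟨ T.·-homo n a (S p) ⟨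
          coeff (T (a · S p)) n      ∎)
    ; inverse =
        (λ {r} {q} q≈Sr n → trans (T.cong n q (S r) q≈Sr) (section r n))
      , (λ {r} {q} q≈Tr → injective (S q) r (λ n → trans (section q n) (q≈Tr n)))
    }
    where
    module T n = IsFunctional (functional-∘ (coeff-functional n) T-op)
    -- Thanks to this, each law of `S` can be checked after applying `T`, where the section property
    -- removes `S`.
    injective : ∀ p q → T p ≈ˣ T q → p ≈ˣ q
    injective p q Tp≈Tq = ≈ˣ-from-difference p q (kernel _ (λ n →
      trans (functional-difference (functional-∘ (coeff-functional n) T-op) p q)
        (trans (+-congʳ (Tp≈Tq n)) (-‿inverseʳ _))))

  -- `T` carries one graded basis to another. The inverse expands a polynomial in the `T (s n)` and
  -- puts `s n` in their place; the kernel is trivial because the `T (s n)` are independent.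
  gradedOperatorInverse : ∀ {T} → IsOperator T → ∀ s → (∀ n → HasDegree (s n) n) →
    (∀ n → HasDegree (T (s n)) n) → ∃[ S ] IsInverseOperator T S
  gradedOperatorInverse {T} T-op s s-degree Ts-degree =
    (λ r → combine s (Ts.coordinates r)) , sectionIsInverse T-op kernel section
    where
    module s  = Graded s s-degree
    module Ts = Graded (T ∘ s) Ts-degree

    section : ∀ r → T (combine s (Ts.coordinates r)) ≈ˣ r
    section r n = trans (operator-combine T-op s (Ts.coordinates r) n) (Ts.combine-coordinates r n)

    kernel : ∀ r → T r ≈ˣ [] → r ≈ˣ []
    kernel r Tr≈0 n = begin
      coeff r n                             ≈⟨ s.combine-coordinates r n ⟨
      coeff (combine s (s.coordinates r)) n ≈⟨ combine-cong s (s.coordinates r) [] coordinates≈0 n ⟩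
      0#                                    ∎
      where
      coordinates≈0 : s.coordinates r ≈ˣ []
      coordinates≈0 = Ts.combine-kernel (s.coordinates r) λ m → begin
        coeff (combine (T ∘ s) (s.coordinates r)) m
          ≈⟨ operator-combine T-op s (s.coordinates r) m ⟨
        coeff (T (combine s (s.coordinates r))) m
          ≈⟨ IsFunctional.cong (functional-∘ (coeff-functional m) T-op) _ r (s.combine-coordinates r) ⟩
        coeff (T r) m                               ≈⟨ Tr≈0 m ⟩
        0#                                          ∎

  -- Division by a linear factor.

  -- For every constant a, the quotient of (a + x p) - (a + e p(e)) by x - e.
  quotient : Carrier → ∣K[x]∣ → ∣K[x]∣
  quotient e []      = []
  quotient e (a ∷ p) = ev e (a ∷ p) ∷ quotient e p

  length-quotient : ∀ e p → length (quotient e p) ≡ length p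
  length-quotient e []      = ≡.refl
  length-quotient e (a ∷ p) = ≡.cong suc (length-quotient e p)

  -- The factor theorem, with the second point written as `e + d` so that no subtraction occurs and
  -- a semiring identity settles each step.
  quotient-spec : ∀ e d a p →
    ev (e + d) (a ∷ p) ≈ ev e (a ∷ p) + d * ev (e + d) (quotient e p)
  quotient-spec e d a [] = begin
    a + (e + d) * 0#      ≈⟨ +-congˡ (distribʳ 0# e d) ⟩
    a + (e * 0# + d * 0#) ≈⟨ +-assoc a _ _ ⟨
    a + e * 0# + d * 0#   ∎
  quotient-spec e d a (b ∷ p) = begin
    a + (e + d) * ev (e + d) (b ∷ p)      ≈⟨ +-congˡ (*-congˡ (quotient-spec e d b p)) ⟩
    a + (e + d) * (v + d * w)
      ≈⟨ solve 5 (λ a e d v w → a :+ (e :+ d) :* (v :+ d :* w)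
                              := (a :+ e :* v) :+ d :* (v :+ (e :+ d) :* w)) refl a e d v w ⟩
    a + e * v + d * (v + (e + d) * w)     ∎
    where
    v = ev e (b ∷ p)
    w = ev (e + d) (quotient e p)

  zero-from-value : ∀ e a p → p ≈ˣ [] → ev e (a ∷ p) ≈ 0# → a ∷ p ≈ˣ []
  zero-from-value e a p p≈0 value≈0 (suc n) = p≈0 n
  zero-from-value e a p p≈0 value≈0 zero    = begin
    a                ≈⟨ +-identityʳ a ⟨
    a + 0#           ≈⟨ +-congˡ (zeroʳ e) ⟨
    a + e * 0#       ≈⟨ +-congˡ (*-congˡ (IsFunctional.cong (ev-functional e) p [] p≈0)) ⟨
    a + e * ev e p   ≈⟨ value≈0 ⟩
    0#               ∎

  -- The entries of the quotient are the values at `e` of the successive tails of `p`. Starting from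
  -- the end, a vanishing tail and a vanishing value force a vanishing head.
  quotient-zero : ∀ e p → quotient e p ≈ˣ [] → p ≈ˣ []
  quotient-zero e []      _   = λ _ → refl
  quotient-zero e (a ∷ p) q≈0 =
    zero-from-value e a p (quotient-zero e p (λ n → q≈0 (suc n))) (q≈0 0)

  -- Polynomial identities from values in characteristic zero.

  module _ (char0 : CharacteristicZero) where

    -- Dividing out the root `e` leaves a shorter list with the roots e + 1, e + 2 and so on. The
    -- length is a separate argument because `quotient e p` is not a subterm.
    roots⇒zero : ∀ l p → length p ≡ l → ∀ e → (∀ n → ev (e + n ×ᴷ 1#) p ≈ 0#) → p ≈ˣ []
    roots⇒zero l       []      _   e roots = λ _ → refl
    roots⇒zero (suc l) (a ∷ p) len e roots = zero-from-value e a p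
      (quotient-zero e p (roots⇒zero l (quotient e p)
        (≡.trans (length-quotient e p) (ℕ.suc-injective len)) (e + 1#) root-quotient))
      root-e
      where
      root-e : ev e (a ∷ p) ≈ 0#
      root-e = trans (ev-congˡ (sym (+-identityʳ e)) (a ∷ p)) (roots 0)

      root-quotient : ∀ n → ev (e + 1# + n ×ᴷ 1#) (quotient e p) ≈ 0#
      -- The n-th point of the quotient is point n + 1 of the polynomial, at distance `d` from `e`;
      -- characteristic zero allows `d` to be cancelled.
      root-quotient n = trans (ev-congˡ (+-assoc e 1# _) (quotient e p))
        (#0-cancelˡ (char0 n) (begin
          d * ev (e + d) (quotient e p)                 ≈⟨ +-identityˡ _ ⟨
          0# + d * ev (e + d) (quotient e p)            ≈⟨ +-congʳ root-e ⟨
          ev e (a ∷ p) + d * ev (e + d) (quotient e p)  ≈⟨ quotient-spec e d a p ⟨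
          ev (e + d) (a ∷ p)                            ≈⟨ roots (suc n) ⟩
          0#                                            ∎))
        where d = suc n ×ᴷ 1#

    ev-injective : ∀ p q → (∀ a → ev a p ≈ ev a q) → p ≈ˣ q
    ev-injective p q p≈q = ≈ˣ-from-difference p q
      -- The roots used are the images of the natural numbers in `K`.
      (roots⇒zero _ (p +ˣ - 1# · q) ≡.refl 0# (λ n → root (0# + n ×ᴷ 1#)))
      where
      root : ∀ a → ev a (p +ˣ - 1# · q) ≈ 0#
      root a = trans (functional-difference (ev-functional a) p q)
        (trans (+-congʳ (p≈q a)) (-‿inverseʳ _))

    -- One variable at a time: for fixed `a` the two polynomials in y have equal values, hence equal
    -- coefficients, and each of these is the value at `a` of a polynomial in x.
    ev₂-injective : ∀ u v → (∀ a b → ev₂ a b u ≈ ev₂ a b v) → u ≈ˣʸ v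
    ev₂-injective u v u≈v n = ev-injective (Y.coeff u n) (Y.coeff v n) (λ a → begin
      ev a (Y.coeff u n)          ≈⟨ coeff-ev a u n ⟨
      coeff (map (ev a) u) n      ≈⟨ ev-injective (map (ev a) u) (map (ev a) v) (λ b → begin
        ev b (map (ev a) u)  ≈⟨ Eᴷ.evaluate-map K[x] id (ev a) b u ⟩
        ev₂ a b u            ≈⟨ u≈v a b ⟩
        ev₂ a b v            ≈⟨ Eᴷ.evaluate-map K[x] id (ev a) b v ⟨
        ev b (map (ev a) v)  ∎) n ⟩
      coeff (map (ev a) v) n      ≈⟨ coeff-ev a v n ⟩
      ev a (Y.coeff v n)          ∎)
      where
      coeff-ev : ∀ a u n → coeff (map (ev a) u) n ≈ ev a (Y.coeff u n)
      coeff-ev a []      n       = refl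
      coeff-ev a (p ∷ u) zero    = refl
      coeff-ev a (p ∷ u) (suc n) = coeff-ev a u n

    -- Equality of values gives equality of polynomials, so a functional, and with it an operator,
    -- can be applied to an identity known only pointwise.
    functional-combination : ∀ {L} → IsFunctional L →
      ∀ {n} (c : Fin n → Carrier) (s : Fin n → ∣K[x]∣) r →
      (∀ b → ev b r ≈ sum (λ i → c i * ev b (s i))) → L r ≈ sum (λ i → c i * L (s i))
    functional-combination {L} L-fun c s r r≈ = begin
      L r                          ≈⟨ IsFunctional.cong L-fun r (linearCombination c s) r≈ˣ ⟩
      L (linearCombination c s)    ≈⟨ functional-linearCombination L-fun c s ⟩
      sum (λ i → c i * L (s i))    ∎
      where
      r≈ˣ : r ≈ˣ linearCombination c s
      r≈ˣ = ev-injective r (linearCombination c s) (λ b →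
        trans (r≈ b) (sym (functional-linearCombination (ev-functional b) c s)))

    functional-convolve : ∀ {L} → IsFunctional L → ∀ c s n r →
      (∀ b → ev b r ≈ convolve c (ev b ∘ s) n) → L r ≈ convolve c (L ∘ s) n
    functional-convolve L-fun c s n r = functional-combination L-fun
      {suc n} (λ i → c (toℕ i)) (λ i → s (n ∸ toℕ i)) r

    isOperator-ev : ∀ φ → (∀ a → IsFunctional (ev a ∘ φ)) → IsOperator φ
    isOperator-ev φ φ-fun = isOperator
      (λ p q p≈q → ev-injective (φ p) (φ q) (λ a → IsFunctional.cong (φ-fun a) p q p≈q))
      (λ p q → ev-injective (φ (p +ˣ q)) (φ p +ˣ φ q) (λ a →
        trans (IsFunctional.+-homo (φ-fun a) p q) (sym (Ev.+-homo a (φ p) (φ q)))))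
      (λ b p → ev-injective (φ (b · p)) (b · φ p) (λ a →
        trans (IsFunctional.·-homo (φ-fun a) b p) (sym (ev-· a b (φ p)))))

    -- At x = a the polynomial `u` is a combination of powers of y with scalar coefficients, and by
    -- linearity `φ` may act on the whole instead of on each power. The whole enters as any `r` with
    -- the right values; for `Eʸ p` it will be `E a p`.
    ev₂-onY : ∀ {φ} → IsOperator φ → ∀ a u r → (∀ b → ev b r ≈ ev₂ a b u) →
              ∀ b → ev₂ a b (onY φ u) ≈ ev b (φ r)
    ev₂-onY {φ} φ-op a u r r≈u b = begin
      ev₂ a b (onY φ u)
        ≈⟨ Eˣʸ.sum-homo (ev₂-hom a b) {length u} _ ⟩
      sum {length u} (λ j → ev₂ a b (lookup u j ⟨x⟩ *ˣʸ φ (var SX.^ toℕ j) ⟨y⟩))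
        ≈⟨ sum-cong-≋ {length u} (λ j → ev₂-product a b (lookup u j) (φ (var SX.^ toℕ j))) ⟩
      sum {length u} (λ j → ev a (lookup u j) * ev b (φ (var SX.^ toℕ j)))
        ≈⟨ functional-combination (functional-∘ (ev-functional b) φ-op)
             (ev a ∘ lookup u) (λ j → var SX.^ toℕ j) r (λ d → begin
               ev d r    ≈⟨ r≈u d ⟩
               ev₂ a d u ≈⟨ Eˣ.evaluate-powers (ev a) d u ⟩
               sum {length u} (λ j → ev a (lookup u j) * d ^ toℕ j)
                 ≈⟨ sum-cong-≋ {length u} (λ j → *-congˡ (power d (toℕ j))) ⟨
               sum {length u} (λ j → ev a (lookup u j) * ev d (var SX.^ toℕ j)) ∎) ⟨
      ev b (φ r) ∎
      where
      power : ∀ d n → ev d (var SX.^ n) ≈ d ^ n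
      power d zero    = Ev.1#-homo d
      power d (suc n) = trans (Ev.*-homo d var (var SX.^ n)) (*-cong (ev-var d) (power d n))

    -- The operator P and its shift-invariance.

    module _ (p : ℕ → ∣K[x]∣) (p-degree : ∀ n → HasDegree (p n) n)
             (F : ∣K[x]∣ → ∣K[x,y]∣) (F-op : IsOperatorˣʸ F) (F-shift : ShiftInvariantˣʸ F)
             where

      private
        P : ∣K[x]∣ → ∣K[x]∣
        P = ε-y ∘ F

        Convolution : Set _
        Convolution = ∀ n → F (p n) ≈ˣʸ Σ≤ n (λ k → p k ⟨x⟩ *ˣʸ p (n ∸ k) ⟨y⟩)

      ε-y∘F-isOperator : IsOperator P
      ε-y∘F-isOperator = isOperator-ev P λ a →
        functional-resp (λ r → ev-ε-y a (F r)) (ev₂-functional F-op a 0#)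

      ev₂-F-shift : ∀ a b d r → ev₂ a b (F (E d r)) ≈ ev₂ (a + d) b (F r)
      ev₂-F-shift a b d r = trans
        (ev₂-cong a b (F (E d r)) (onX (E d) (F r)) (F-shift d r))
        (ev₂-onX-E a b d (F r))

      ε-y∘F-shiftInvariant : ShiftInvariant P
      ε-y∘F-shiftInvariant d r = ev-injective (P (E d r)) (E d (P r)) λ a → begin
        ev a (P (E d r))         ≈⟨ ev-ε-y a (F (E d r)) ⟩
        ev₂ a 0# (F (E d r))     ≈⟨ ev₂-F-shift a 0# d r ⟩
        ev₂ (a + d) 0# (F r)     ≈⟨ ev-ε-y (a + d) (F r) ⟨
        ev (a + d) (P r)         ≈⟨ ev-E a d (P r) ⟨
        ev a (E d (P r))         ∎

      -- From (2) to (1).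

      sheffer⇒convolution : ∀ {Q} → IsInverseOperator P Q → IsSheffer (Q ∘ p) p →
        (∀ r → F r ≈ˣʸ onY P (Eʸ r)) → Convolution
      sheffer⇒convolution {Q} Q-inv sheffer F≈ n = ev₂-injective (F (p n)) p*p λ a b → begin
        ev₂ a b (F (p n))
          ≈⟨ ev₂-cong a b (F (p n)) (onY P (Eʸ (p n))) (F≈ (p n)) ⟩
        ev₂ a b (onY P (Eʸ (p n)))
          ≈⟨ ev₂-onY ε-y∘F-isOperator a (Eʸ (p n)) (E a (p n)) (λ d → ev-E-Eʸ a d (p n)) b ⟩
        ev b (P (E a (p n)))
          -- At x = a the Sheffer identity expands `E a (p n)` in the polynomials `Q (p k)` with
          -- scalar coefficients; `P` acts on each of them and will turn it into `p k`.
          ≈⟨ functional-convolve (functional-∘ (ev-functional b) ε-y∘F-isOperator)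
               (ev a ∘ p) (Q ∘ p) n (E a (p n)) (λ d → begin
                 ev d (E a (p n))      ≈⟨ ev-E-Eʸ a d (p n) ⟩
                 ev₂ a d (Eʸ (p n))
                   ≈⟨ ev₂-cong a d (Eʸ (p n)) q*p (IsSheffer.binomial sheffer n) ⟩
                 ev₂ a d q*p           ≈⟨ ev₂-convolution′ p (Q ∘ p) n a d ⟩
                 convolve (ev a ∘ p) (ev d ∘ Q ∘ p) n ∎) ⟩
        convolve (ev a ∘ p) (ev b ∘ P ∘ Q ∘ p) n
          ≈⟨ convolve-cong (ev a ∘ p) (λ k → Ev.⟦⟧-cong b {P (Q (p k))} {p k} (P∘Q (p k))) n ⟩
        convolve (ev a ∘ p) (ev b ∘ p) n
          ≈⟨ ev₂-convolution p p n a b ⟨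
        ev₂ a b p*p ∎
        where
        p*p = Σ≤ n (λ k → p k ⟨x⟩ *ˣʸ p (n ∸ k) ⟨y⟩)
        q*p = Σ≤ n (λ k → Q (p (n ∸ k)) ⟨y⟩ *ˣʸ p k ⟨x⟩)

        P∘Q : ∀ r → P (Q r) ≈ˣ r
        P∘Q r = proj₁ (IsInverseOperator.inverse Q-inv) {r} {Q r} (λ _ → refl)

      -- From (1) to (2).

      module FromConvolution (convolution : Convolution) where

        ev₂-F-p : ∀ n a b → ev₂ a b (F (p n)) ≈ convolve (ev a ∘ p) (ev b ∘ p) n
        ev₂-F-p n a b = trans
          (ev₂-cong a b (F (p n)) (Σ≤ n (λ k → p k ⟨x⟩ *ˣʸ p (n ∸ k) ⟨y⟩)) (convolution n))
          (ev₂-convolution p p n a b)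

        F-symmetric : ∀ a b r → ev₂ a b (F r) ≈ ev₂ b a (F r)
        F-symmetric a b = Graded.functionals-agree p p-degree
          (ev₂-functional F-op a b) (ev₂-functional F-op b a) λ n →
            trans (ev₂-F-p n a b)
              (trans (convolve-comm (ev a ∘ p) (ev b ∘ p) n) (sym (ev₂-F-p n b a)))

        -- Symmetry lets a shift be moved from one variable to the other.
        ev₂-F : ∀ a b r → ev₂ a b (F r) ≈ ev b (P (E a r))
        ev₂-F a b r = begin
          ev₂ a b (F r)           ≈⟨ ev₂-congᵃ (+-identityˡ a) refl (F r) ⟨
          ev₂ (0# + a) b (F r)    ≈⟨ ev₂-F-shift 0# b a r ⟨
          ev₂ 0# b (F (E a r))    ≈⟨ F-symmetric 0# b (E a r) ⟩
          ev₂ b 0# (F (E a r))    ≈⟨ ev-ε-y b (F (E a r)) ⟨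
          ev b (P (E a r))        ∎

        F≈onY-P∘Eʸ : ∀ r → F r ≈ˣʸ onY P (Eʸ r)
        F≈onY-P∘Eʸ r = ev₂-injective (F r) (onY P (Eʸ r)) λ a b → trans (ev₂-F a b r)
          (sym (ev₂-onY ε-y∘F-isOperator a (Eʸ r) (E a r) (λ d → ev-E-Eʸ a d r) b))

        constantTerm : ℕ → Carrier
        constantTerm = ev 0# ∘ p

        constantTerm₀#0 : constantTerm 0 # 0#
        constantTerm₀#0 = #-congʳ (sym (ev-0 (p 0))) (proj₁ (p-degree 0))

        -- Setting y = 0 in (1) expands `P (p n)` in the `p k` with constant terms as coefficients.
        -- The factors are exchanged so that `p n` stands at index 0, as `convolve-coeff` expects.
        functional-P-p : ∀ {L} → IsFunctional L →
          ∀ n → L (P (p n)) ≈ convolve constantTerm (L ∘ p) n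
        functional-P-p L-fun n = functional-convolve L-fun constantTerm p n (P (p n)) λ b → begin
          ev b (P (p n))                        ≈⟨ ev-ε-y b (F (p n)) ⟩
          ev₂ b 0# (F (p n))                    ≈⟨ ev₂-F-p n b 0# ⟩
          convolve (ev b ∘ p) constantTerm n    ≈⟨ convolve-comm (ev b ∘ p) constantTerm n ⟩
          convolve constantTerm (ev b ∘ p) n    ∎

        -- In degrees n and above, `P (p n)` coincides with `p n` times the nonzero scalar
        -- `constantTerm 0`.
        P-p-degree : ∀ n → HasDegree (P (p n)) n
        P-p-degree n =
            #-congʳ (sym (high n ℕ.≤-refl)) (x#0y#0→xy#0 constantTerm₀#0 (proj₁ (p-degree n)))
          , λ m n<m → trans (high m (ℕ.<⇒≤ n<m))
              (trans (*-congˡ (proj₂ (p-degree n) m n<m)) (zeroʳ _))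
          where
          high : ∀ m → n ℕ.≤ m → coeff (P (p n)) m ≈ constantTerm 0 * coeff (p n) m
          high = convolve-coeff constantTerm p (P (p n)) n
            (λ m → functional-P-p (coeff-functional m) n) (λ k _ → p-degree k)

        P-inverse : ∃[ Q ] IsInverseOperator P Q
        P-inverse = gradedOperatorInverse ε-y∘F-isOperator p p-degree P-p-degree

        Q : ∣K[x]∣ → ∣K[x]∣
        Q = proj₁ P-inverse

        Q-isInverse : IsInverseOperator P Q
        Q-isInverse = proj₂ P-inverse

        open IsInverseOperator Q-isInverse using (inverse) renaming (isOperator to Q-op)

        P∘Q : ∀ r → P (Q r) ≈ˣ r
        P∘Q r = proj₁ inverse {r} {Q r} (λ _ → refl)

        Q∘P : ∀ r → Q (P r) ≈ˣ r
        Q∘P r = proj₂ inverse {r} {P r} (λ _ → refl)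

        -- By the inverse law it is enough that `P` sends `E d (Q r)` to `E d r`, and `P` commutes
        -- with `E d`.
        Q-shiftInvariant : ShiftInvariant Q
        Q-shiftInvariant d r = proj₂ inverse {E d (Q r)} {E d r} λ n → sym (begin
          coeff (P (E d (Q r))) n    ≈⟨ ε-y∘F-shiftInvariant d (Q r) n ⟩
          -- That `E d` respects the equality of `P (Q r)` and `r` is seen on values.
          coeff (E d (P (Q r))) n    ≈⟨ ev-injective (E d (P (Q r))) (E d r) (λ a → begin
            ev a (E d (P (Q r)))       ≈⟨ ev-E a d (P (Q r)) ⟩
            ev (a + d) (P (Q r))       ≈⟨ Ev.⟦⟧-cong (a + d) {P (Q r)} {r} (P∘Q r) ⟩
            ev (a + d) r               ≈⟨ ev-E a d r ⟨
            ev a (E d r)               ∎) n ⟩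
          coeff (E d r) n            ∎)

        -- Applying `Q` to the expansion of `P (p n)` expands `p n` in the `Q (p k)`. By induction
        -- those with k < n have degree k, so from degree n upwards `p n` is `constantTerm 0` times
        -- `Q (p n)`.
        Q-p-degree : ∀ n → HasDegree (Q (p n)) n
        Q-p-degree = <-rec (λ n → HasDegree (Q (p n)) n) λ n below →
          let high = convolve-coeff constantTerm (Q ∘ p) (p n) n
                (λ m → trans (sym (Q∘P (p n) m))
                  (functional-P-p (functional-∘ (coeff-functional m) Q-op) n))
                (λ k k<n → below k<n)
          in xy#0→y#0 (#-congʳ (high n ℕ.≤-refl) (proj₁ (p-degree n)))
           , λ m n<m → #0-cancelˡ constantTerm₀#0
               (trans (sym (high m (ℕ.<⇒≤ n<m))) (proj₂ (p-degree n) m n<m))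

        -- The Sheffer identity on values. At x = a, (1) expands `P (E a (p n))` in the `p k`, and
        -- `Q` applied in y undoes `P` on one side and acts on each `p k` on the other.
        ev-E-p : ∀ n a b → ev b (E a (p n)) ≈ convolve (ev a ∘ p) (ev b ∘ Q ∘ p) n
        ev-E-p n a b = begin
          ev b (E a (p n))
            ≈⟨ Ev.⟦⟧-cong b {Q (P (E a (p n)))} {E a (p n)} (Q∘P (E a (p n))) ⟨
          ev b (Q (P (E a (p n))))
            ≈⟨ functional-convolve (functional-∘ (ev-functional b) Q-op)
                 (ev a ∘ p) p n (P (E a (p n)))
                 (λ d → trans (sym (ev₂-F a d (p n))) (ev₂-F-p n a d)) ⟩
          convolve (ev a ∘ p) (ev b ∘ Q ∘ p) n ∎

        -- Here `Q` acts in x. For y = b the Sheffer identity expands `E b (p n)` in the `p k` with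
        -- the values of the `Q (p k)` at b as coefficients, and shift-invariance moves `Q` past
        -- `E b`.
        ev-E-Q-p : ∀ n a b → ev a (E b (Q (p n))) ≈ convolve (ev a ∘ Q ∘ p) (ev b ∘ Q ∘ p) n
        ev-E-Q-p n a b = begin
          ev a (E b (Q (p n)))
            ≈⟨ Ev.⟦⟧-cong a {Q (E b (p n))} {E b (Q (p n))} (Q-shiftInvariant b (p n)) ⟨
          ev a (Q (E b (p n)))
            ≈⟨ functional-convolve (functional-∘ (ev-functional a) Q-op)
                 (ev b ∘ Q ∘ p) p n (E b (p n)) (λ d → begin
                   ev d (E b (p n))                      ≈⟨ ev-E-comm d b (p n) ⟩
                   ev b (E d (p n))                      ≈⟨ ev-E-p n d b ⟩
                   convolve (ev d ∘ p) (ev b ∘ Q ∘ p) n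
                     ≈⟨ convolve-comm (ev d ∘ p) (ev b ∘ Q ∘ p) n ⟩
                   convolve (ev b ∘ Q ∘ p) (ev d ∘ p) n  ∎) ⟩
          convolve (ev b ∘ Q ∘ p) (ev a ∘ Q ∘ p) n
            ≈⟨ convolve-comm (ev b ∘ Q ∘ p) (ev a ∘ Q ∘ p) n ⟩
          convolve (ev a ∘ Q ∘ p) (ev b ∘ Q ∘ p) n ∎

        sheffer : IsSheffer (Q ∘ p) p
        sheffer = record
          { isDividedPower = record
            { degree   = Q-p-degree
            ; binomial = λ n →
                ev₂-injective (Eʸ (Q (p n))) (Σ≤ n (λ k → Q (p k) ⟨x⟩ *ˣʸ Q (p (n ∸ k)) ⟨y⟩))
                λ a b → trans (sym (ev-E-Eʸ a b (Q (p n)))) (trans (ev-E-comm b a (Q (p n)))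
                  (trans (ev-E-Q-p n a b) (sym (ev₂-convolution (Q ∘ p) (Q ∘ p) n a b))))
            }
          ; degree   = p-degree
          ; binomial = λ n →
              ev₂-injective (Eʸ (p n)) (Σ≤ n (λ k → Q (p (n ∸ k)) ⟨y⟩ *ˣʸ p k ⟨x⟩))
              λ a b → trans (sym (ev-E-Eʸ a b (p n)))
                (trans (ev-E-p n a b) (sym (ev₂-convolution′ p (Q ∘ p) n a b)))
          }

theorem1 : ∀ {c ℓ₁ ℓ₂} (K : HeytingField c ℓ₁ ℓ₂) → let open Operators K in
    CharacteristicZero →
    (p : ℕ → ∣K[x]∣) → (∀ n → HasDegree (p n) n) →
    (F : ∣K[x]∣ → ∣K[x,y]∣) → IsOperatorˣʸ F → ShiftInvariantˣʸ F →
    let P = ε-y ∘ F in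
    (∀ n → F (p n) ≈ˣʸ Σ≤ n (λ k → p k ⟨x⟩ *ˣʸ p (n ∸ k) ⟨y⟩))
    ⇔
    ( IsOperator P × ShiftInvariant P
    × (∃[ P⁻¹ ] IsInverseOperator P P⁻¹ × IsSheffer (P⁻¹ ∘ p) p)
    × (∀ r → F r ≈ˣʸ onY P (Eʸ r)) )
theorem1 K char0 p p-degree F F-op F-shift = mk⇔
  (λ convolution →
    let module C = FromConvolution K char0 p p-degree F F-op F-shift convolution in
      ε-y∘F-isOperator K char0 p p-degree F F-op F-shift
    , ε-y∘F-shiftInvariant K char0 p p-degree F F-op F-shift
    , (C.Q , C.Q-isInverse , C.sheffer)
    , C.F≈onY-P∘Eʸ)
  (λ (_ , _ , (_ , inverse , sheffer) , F≈onY-P∘Eʸ) →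
    sheffer⇒convolution K char0 p p-degree F F-op F-shift inverse sheffer F≈onY-P∘Eʸ)
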